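{- Let $H$ be a realizable 3-uniform hypergraph and let $T$ be a realization of $H$. Then $H$ is prime if and only if $T$ is prime.
   Context: All structures are finite. A 3-uniform hypergraph $H$ consists of a vertex set $V(H)$ and an edge set $E(H)\subseteq\binom{V(H)}{3}$. A tournament $T$ has a vertex set $V(T)$ and an arc set $A(T)$ such that for distinct $v,w\in V(T)$ exactly one of $vw,wv$ belongs to $A(T)$ (and there are no loops). A 3-cycle is a tournament on three vertices isomorphic to $(\{0,1,2\},\{01,12,20\})$. The $C_3$-structure $C_3(T)$ of a tournament $T$ is the 3-uniform hypergraph on $V(T)$ whose edges are the 3-element subsets $X$ of $V(T)$ such that $T[X]$ is a 3-cycle. A tournament $T$ with $V(T)=V(H)$ is a realization of $H$ if $H=C_3(T)$; $H$ is realizable if it admits a realization. A subset $M$ of $V(H)$ is a module of the hypergraph $H$ if for each $e\in E(H)$ such that $e\cap M\neq\emptyset$ and $e\setminus M\neq\emptyset$, there exists $m\in M$ such that $e\cap M=\{m\}$ and for every $n\in M$, $(e\setminus\{m\})\cup\{n\}\in E(H)$. A subset $M$ of $V(T)$ is a module of the tournament $T$ if for any $x,y\in M$ and $v\in V(T)$, if $xv,vy\in A(T)$, then $v\in M$. The empty set, the whole vertex set and the singletons are modules, called trivial. A hypergraph (resp. tournament) is prime if it has at least $3$ vertices and all its modules are trivial. -}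

module Defs where

open import Data.Fin using (Fin; zero; suc)
open import Data.Fin.Subset using (Subset; _∈_; ⊥; ⊤; ⁅_⁆; _∩_; _∪_; _─_; ∣_∣; Nonempty)
open import Data.Nat using (ℕ; _≤_)
open import Data.Product using (Σ; ∃; _×_; _,_; proj₁; proj₂)
open import Data.Sum using (_⊎_; inj₁; inj₂)
open import Data.Vec.Properties.WithK using ([]=-irrelevant)
open import Function using (_∘_)
open import Function.Bundles using (_⇔_; _↔_; Inverse)
open import Relation.Binary.PropositionalEquality using (_≡_; _≢_; refl; cong)
open import Relation.Nullary using (¬_; contradiction)

-- The vertex set of a finite structure is Fin n, so that V(T) = V(H) holds by
-- sharing the index n.
record Hypergraph (n : ℕ) : Set₁ where
  field
    E       : Subset n → Set
    uniform : ∀ {e} → E e → ∣ e ∣ ≡ 3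

-- The vertex type is arbitrary so that T [ X ] can have the elements of X as
-- its vertices.
record Tournament (V : Set) : Set₁ where
  field
    A          : V → V → Set
    loopless   : ∀ {v} → ¬ A v v
    exactlyOne : ∀ {v w} → v ≢ w → (A v w × ¬ A w v) ⊎ (A w v × ¬ A v w)

_≅_ : ∀ {V W} → Tournament V → Tournament W → Set
_≅_ {V} {W} T U = Σ (V ↔ W) λ f → ∀ v w →
  Tournament.A T v w ⇔ Tournament.A U (Inverse.to f v) (Inverse.to f w)

_[_] : ∀ {n} → Tournament (Fin n) → (X : Subset n) → Tournament (∃ λ v → v ∈ X)
T [ X ] = record
  { A          = λ x y → A (proj₁ x) (proj₁ y)
  ; loopless   = loopless
  ; exactlyOne = λ x≢y → exactlyOne (x≢y ∘ proj₁-injective)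
  }
  where
  open Tournament T
  proj₁-injective : {x y : ∃ λ v → v ∈ X} → proj₁ x ≡ proj₁ y → x ≡ y
  proj₁-injective {v , p} {.v , q} refl = cong (v ,_) ([]=-irrelevant p q)

data CycleArc : Fin 3 → Fin 3 → Set where
  arc01 : CycleArc zero (suc zero)
  arc12 : CycleArc (suc zero) (suc (suc zero))
  arc20 : CycleArc (suc (suc zero)) zero

cycle₃ : Tournament (Fin 3)
cycle₃ = record { A = CycleArc ; loopless = λ () ; exactlyOne = λ {v} {w} → one v w }
  where
  one : ∀ v w → v ≢ w →
        (CycleArc v w × ¬ CycleArc w v) ⊎ (CycleArc w v × ¬ CycleArc v w)
  one zero             zero             v≢w = contradiction refl v≢w
  one zero             (suc zero)       _   = inj₁ (arc01 , λ ())
  one zero             (suc (suc zero)) _   = inj₂ (arc20 , λ ())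
  one (suc zero)       zero             _   = inj₂ (arc01 , λ ())
  one (suc zero)       (suc zero)       v≢w = contradiction refl v≢w
  one (suc zero)       (suc (suc zero)) _   = inj₁ (arc12 , λ ())
  one (suc (suc zero)) zero             _   = inj₁ (arc20 , λ ())
  one (suc (suc zero)) (suc zero)       _   = inj₂ (arc12 , λ ())
  one (suc (suc zero)) (suc (suc zero)) v≢w = contradiction refl v≢w

Is3Cycle : ∀ {V} → Tournament V → Set
Is3Cycle T = T ≅ cycle₃

C₃ : ∀ {n} → Tournament (Fin n) → Hypergraph n
C₃ T = record { E = λ X → ∣ X ∣ ≡ 3 × Is3Cycle (T [ X ]) ; uniform = proj₁ }

-- The relation plays the role of equality: edge sets are predicates, so
-- H = C₃ T means that both have the same edges.
_≐_ : ∀ {n} → Hypergraph n → Hypergraph n → Set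
H ≐ K = ∀ e → Hypergraph.E H e ⇔ Hypergraph.E K e

_Realizes_ : ∀ {n} → Tournament (Fin n) → Hypergraph n → Set
T Realizes H = H ≐ C₃ T

Realizable : ∀ {n} → Hypergraph n → Set₁
Realizable {n} H = Σ (Tournament (Fin n)) λ T → T Realizes H

IsHypergraphModule : ∀ {n} → Hypergraph n → Subset n → Set
IsHypergraphModule H M = ∀ e → E e → Nonempty (e ∩ M) → Nonempty (e ─ M) →
  ∃ λ m → m ∈ M × e ∩ M ≡ ⁅ m ⁆ × (∀ v → v ∈ M → E ((e ─ ⁅ m ⁆) ∪ ⁅ v ⁆))
  where open Hypergraph H

IsTournamentModule : ∀ {n} → Tournament (Fin n) → Subset n → Set
IsTournamentModule T M = ∀ x y v → x ∈ M → y ∈ M → A x v → A v y → v ∈ M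
  where open Tournament T

Trivial : ∀ {n} → Subset n → Set
Trivial M = M ≡ ⊥ ⊎ M ≡ ⊤ ⊎ ∃ λ v → M ≡ ⁅ v ⁆

PrimeHypergraph : ∀ {n} → Hypergraph n → Set
PrimeHypergraph {n} H = 3 ≤ n × (∀ M → IsHypergraphModule H M → Trivial M)

PrimeTournament : ∀ {n} → Tournament (Fin n) → Set
PrimeTournament {n} T = 3 ≤ n × (∀ M → IsTournamentModule T M → Trivial M)

{-# OPTIONS --safe #-}
-- A module of T is a module of C₃(T), because all its vertices see an outside
-- vertex in the same way; this gives one direction.  Conversely, let M be a
-- nontrivial module of C₃(T) and let I be the set of the vertices outside M
-- that have both in-neighbours and out-neighbours in M.  Then M ∪ I is a module
-- of T, so we may assume that M ∪ I is everything.  For v ∈ I, write M⁻(v) for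
-- the set of in-neighbours of v in M.  No 3-cycle has exactly two vertices in M,
-- so M⁻(v) dominates the rest of M, and hence the sets M⁻(v) form a chain.  The
-- least of them dominates its complement, which is therefore a nontrivial module
-- of T.
module Submission where

open import Defs
open import Data.Fin using (Fin; zero; suc; _≟_)
open import Data.Fin.Properties using (any?)
open import Data.Fin.Subset
  using (Subset; inside; outside; _∈_; _∉_; _⊆_; _⊂_; ⊥; ⊤; ⁅_⁆; ∁; _∩_; _∪_; _─_; ∣_∣)
open import Data.Fin.Subset.Induction using (⊂-wellFounded; Acc; acc)
open import Data.Fin.Subset.Properties
  using ( _∈?_; nonempty?; Empty-unique; ∉⊥; ∈⊤; ⊆⊤; x∈⁅x⁆; x∈⁅y⁆⇒x≡y; ∣⁅x⁆∣≡1; ⊆-antisym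
        ; x∈∁p⇒x∉p; x∉p⇒x∈∁p; x∈p∩q⁺; x∈p∩q⁻; x∈p∪q⁺; x∈p∪q⁻; x∈p∧x∉q⇒x∈p─q; p─q⊆p )
open import Data.Nat using (ℕ; suc)
open import Data.Product using (∃; ∃₂; _×_; _,_; proj₁; proj₂; map₂)
open import Data.Sum using (_⊎_; inj₁; inj₂)
open import Data.Vec using ([]; _∷_; here; there; tabulate)
open import Data.Vec.Properties using ([]=⇒lookup; lookup⇒[]=; lookup∘tabulate)
open import Data.Vec.Properties.WithK using ([]=-irrelevant)
open import Function using (_∘_)
open import Function.Bundles using (_⇔_; Injection; Inverse; Equivalence; mk⇔; mk↔ₛ′)
open import Function.Properties.Inverse using (Inverse⇒Injection)
open import Relation.Binary.PropositionalEquality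
  using (_≡_; _≢_; refl; sym; trans; cong; subst; subst₂)
open import Relation.Nullary
  using (¬_; Dec; yes; no; does; contradiction; ¬?; decidable-stable; _×-dec_)
open import Relation.Nullary.Decidable using (dec-true)
open import Relation.Unary using (Decidable)

private variable
  n : ℕ

-- Three-element subsets and their cardinality.

⁅_⨾_⨾_⁆ : Fin n → Fin n → Fin n → Subset n
⁅ a ⨾ b ⨾ c ⁆ = ⁅ a ⁆ ∪ (⁅ b ⁆ ∪ ⁅ c ⁆)

∈⁅⨾⨾⁆⁻ : ∀ {a b c x : Fin n} → x ∈ ⁅ a ⨾ b ⨾ c ⁆ → x ≡ a ⊎ x ≡ b ⊎ x ≡ c
∈⁅⨾⨾⁆⁻ {a = a} {b} {c} x∈ with x∈p∪q⁻ ⁅ a ⁆ _ x∈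
... | inj₁ x∈a = inj₁ (x∈⁅y⁆⇒x≡y a x∈a)
... | inj₂ x∈bc with x∈p∪q⁻ ⁅ b ⁆ ⁅ c ⁆ x∈bc
...   | inj₁ x∈b = inj₂ (inj₁ (x∈⁅y⁆⇒x≡y b x∈b))
...   | inj₂ x∈c = inj₂ (inj₂ (x∈⁅y⁆⇒x≡y c x∈c))

∈⁅⨾⨾⁆⁺ : ∀ {a b c x : Fin n} → x ≡ a ⊎ x ≡ b ⊎ x ≡ c → x ∈ ⁅ a ⨾ b ⨾ c ⁆
∈⁅⨾⨾⁆⁺ (inj₁ refl)        = x∈p∪q⁺ (inj₁ (x∈⁅x⁆ _))
∈⁅⨾⨾⁆⁺ (inj₂ (inj₁ refl)) = x∈p∪q⁺ (inj₂ (x∈p∪q⁺ (inj₁ (x∈⁅x⁆ _))))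
∈⁅⨾⨾⁆⁺ (inj₂ (inj₂ refl)) = x∈p∪q⁺ (inj₂ (x∈p∪q⁺ (inj₂ (x∈⁅x⁆ _))))

-- The tail of `⁅ zero ⁆` is `⊥`, so this is the count that remains once `zero` has been inserted.
∣⊥∪p∣≡∣p∣ : ∀ (p : Subset n) → ∣ ⊥ ∪ p ∣ ≡ ∣ p ∣
∣⊥∪p∣≡∣p∣ []    = refl
∣⊥∪p∣≡∣p∣ (inside  ∷ p) = cong suc (∣⊥∪p∣≡∣p∣ p)
∣⊥∪p∣≡∣p∣ (outside ∷ p) = ∣⊥∪p∣≡∣p∣ p

x∉p⇒∣⁅x⁆∪p∣≡1+∣p∣ : ∀ (x : Fin n) p → x ∉ p → ∣ ⁅ x ⁆ ∪ p ∣ ≡ suc ∣ p ∣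
x∉p⇒∣⁅x⁆∪p∣≡1+∣p∣ zero    (inside  ∷ p) x∉p = contradiction here x∉p
x∉p⇒∣⁅x⁆∪p∣≡1+∣p∣ zero    (outside ∷ p) x∉p = cong suc (∣⊥∪p∣≡∣p∣ p)
x∉p⇒∣⁅x⁆∪p∣≡1+∣p∣ (suc x) (inside  ∷ p) x∉p = cong suc (x∉p⇒∣⁅x⁆∪p∣≡1+∣p∣ x p (x∉p ∘ there))
x∉p⇒∣⁅x⁆∪p∣≡1+∣p∣ (suc x) (outside ∷ p) x∉p = x∉p⇒∣⁅x⁆∪p∣≡1+∣p∣ x p (x∉p ∘ there)

∣⁅a⨾b⨾c⁆∣≡3 : ∀ {a b c : Fin n} → a ≢ b → a ≢ c → b ≢ c → ∣ ⁅ a ⨾ b ⨾ c ⁆ ∣ ≡ 3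
∣⁅a⨾b⨾c⁆∣≡3 {a = a} {b} {c} a≢b a≢c b≢c =
  trans (x∉p⇒∣⁅x⁆∪p∣≡1+∣p∣ a _ a∉)
    (cong suc (trans (x∉p⇒∣⁅x⁆∪p∣≡1+∣p∣ b _ (b≢c ∘ x∈⁅y⁆⇒x≡y c)) (cong suc (∣⁅x⁆∣≡1 c))))
  where
  a∉ : a ∉ ⁅ b ⁆ ∪ ⁅ c ⁆
  a∉ a∈ with x∈p∪q⁻ ⁅ b ⁆ ⁅ c ⁆ a∈
  ... | inj₁ a∈b = a≢b (x∈⁅y⁆⇒x≡y b a∈b)
  ... | inj₂ a∈c = a≢c (x∈⁅y⁆⇒x≡y c a∈c)

x∈p─q⇒x∉q : ∀ (p q : Subset n) {x} → x ∈ p ─ q → x ∉ q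
x∈p─q⇒x∉q (s ∷ p) (inside  ∷ q) {zero}  ()
x∈p─q⇒x∉q (s ∷ p) (outside ∷ q) {zero}  _          ()
x∈p─q⇒x∉q (s ∷ p) (inside  ∷ q) {suc x} (there x∈) (there x∈q) = x∈p─q⇒x∉q p q x∈ x∈q
x∈p─q⇒x∉q (s ∷ p) (outside ∷ q) {suc x} (there x∈) (there x∈q) = x∈p─q⇒x∉q p q x∈ x∈q

module _ {P : Fin n → Set} (P? : Decidable P) where

  satisfying : Subset n
  satisfying = tabulate (does ∘ P?)

  ∈-satisfying⁺ : ∀ {x} → P x → x ∈ satisfying
  ∈-satisfying⁺ {x} px =
    lookup⇒[]= x _ (trans (lookup∘tabulate _ x) (dec-true (P? x) px))

  ∈-satisfying⁻ : ∀ {x} → x ∈ satisfying → P x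
  ∈-satisfying⁻ {x} x∈ with P? x | trans (sym (lookup∘tabulate (does ∘ P?) x)) ([]=⇒lookup x∈)
  ... | yes px | _  = px
  ... | no  _  | ()

-- Trivial and nontrivial vertex sets.

trivial-⊤ : ∀ {M : Subset n} {x y} → Trivial M → x ∈ M → y ∈ M → x ≢ y → ∀ z → z ∈ M
trivial-⊤ (inj₁ refl)              x∈ y∈ x≢y z = contradiction x∈ ∉⊥
trivial-⊤ (inj₂ (inj₁ refl))       x∈ y∈ x≢y z = ∈⊤
trivial-⊤ (inj₂ (inj₂ (v , refl))) x∈ y∈ x≢y z =
  contradiction (trans (x∈⁅y⁆⇒x≡y v x∈) (sym (x∈⁅y⁆⇒x≡y v y∈))) x≢y

-- Put positively: the converse direction starts from two vertices inside and one outside.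
Nontrivial : Subset n → Set
Nontrivial M = (∃₂ λ x y → x ∈ M × y ∈ M × x ≢ y) × ∃ λ z → z ∉ M

trivial⊎nontrivial : (M : Subset n) → Trivial M ⊎ Nontrivial M
trivial⊎nontrivial M with nonempty? M
... | no  M-empty = inj₁ (inj₁ (Empty-unique M-empty))
... | yes (x , x∈M) with any? (λ y → (y ∈? M) ×-dec ¬? (x ≟ y))
...   | no  none = inj₁ (inj₂ (inj₂ (x , ⊆-antisym M⊆x x⊆M)))
  where
  M⊆x : M ⊆ ⁅ x ⁆
  M⊆x {y} y∈M with x ≟ y
  ... | yes refl = x∈⁅x⁆ x
  ... | no  x≢y  = contradiction (y , y∈M , x≢y) none
  x⊆M : ⁅ x ⁆ ⊆ M
  x⊆M y∈ = subst (_∈ M) (sym (x∈⁅y⁆⇒x≡y x y∈)) x∈M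
...   | yes (y , y∈M , x≢y) with any? (λ z → ¬? (z ∈? M))
...     | yes z∉M = inj₂ ((x , y , x∈M , y∈M , x≢y) , z∉M)
...     | no  none = inj₁ (inj₂ (inj₁ (⊆-antisym ⊆⊤ λ {z} _ →
            decidable-stable (z ∈? M) λ z∉M → none (z , z∉M))))

-- The cyclic order on the model 3-cycle.

next : Fin 3 → Fin 3
next zero             = suc zero
next (suc zero)       = suc (suc zero)
next (suc (suc zero)) = zero

arc-next : ∀ i → CycleArc i (next i)
arc-next zero             = arc01
arc-next (suc zero)       = arc12
arc-next (suc (suc zero)) = arc20

next³ : ∀ i → next (next (next i)) ≡ i
next³ zero             = refl
next³ (suc zero)       = refl
next³ (suc (suc zero)) = refl

next-covers : ∀ i j → j ≡ i ⊎ j ≡ next i ⊎ j ≡ next (next i)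
next-covers zero             zero             = inj₁ refl
next-covers zero             (suc zero)       = inj₂ (inj₁ refl)
next-covers zero             (suc (suc zero)) = inj₂ (inj₂ refl)
next-covers (suc zero)       zero             = inj₂ (inj₂ refl)
next-covers (suc zero)       (suc zero)       = inj₁ refl
next-covers (suc zero)       (suc (suc zero)) = inj₂ (inj₁ refl)
next-covers (suc (suc zero)) zero             = inj₂ (inj₁ refl)
next-covers (suc (suc zero)) (suc zero)       = inj₂ (inj₂ refl)
next-covers (suc (suc zero)) (suc (suc zero)) = inj₁ refl

arc⇒≡next : ∀ {i j} → CycleArc i j → j ≡ next i
arc⇒≡next arc01 = refl
arc⇒≡next arc12 = refl
arc⇒≡next arc20 = refl

arc-third : ∀ {i j k} → CycleArc i j → k ≢ i → k ≢ j → CycleArc j k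
arc-third {i} {j} {k} i→j k≢i k≢j with arc⇒≡next i→j | next-covers i k
... | refl | inj₁ k≡i        = contradiction k≡i k≢i
... | refl | inj₂ (inj₁ k≡j) = contradiction k≡j k≢j
... | refl | inj₂ (inj₂ refl) = arc-next (next i)

-- Edges of `C₃ T` as directed 3-cycles.

module _ (T : Tournament (Fin n)) where
  open Tournament T
  open Hypergraph (C₃ T) using (E)

  asym : ∀ {v w} → A v w → ¬ A w v
  asym {v} {w} v→w w→v with v ≟ w
  ... | yes refl = loopless v→w
  ... | no  v≢w with exactlyOne v≢w
  ...   | inj₁ (_ , w↛v) = w↛v w→v
  ...   | inj₂ (_ , v↛w) = v↛w v→w

  arc⇒≢ : ∀ {v w} → A v w → v ≢ w
  arc⇒≢ v→w refl = loopless v→w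

  ↛⇒← : ∀ {v w} → v ≢ w → ¬ A v w → A w v
  ↛⇒← v≢w v↛w with exactlyOne v≢w
  ... | inj₁ (v→w , _) = contradiction v→w v↛w
  ... | inj₂ (w→v , _) = w→v

  A? : ∀ v w → Dec (A v w)
  A? v w with v ≟ w
  ... | yes refl = no loopless
  ... | no  v≢w with exactlyOne v≢w
  ...   | inj₁ (v→w , _) = yes v→w
  ...   | inj₂ (_ , v↛w) = no v↛w

  cycle⇒edge : ∀ {a b c} → A a b → A b c → A c a → E ⁅ a ⨾ b ⨾ c ⁆
  cycle⇒edge {a} {b} {c} a→b b→c c→a =
    ∣⁅a⨾b⨾c⁆∣≡3 (arc⇒≢ a→b) (arc⇒≢ c→a ∘ sym) (arc⇒≢ b→c) ,
    mk↔ₛ′ (λ (_ , x∈) → label x∈) (λ i → vertex i , vertex∈ i)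
      (λ i → vertex-injective (vertex-label (vertex∈ i)))
      (λ (_ , x∈) → ∃-≡ (vertex-label x∈)) ,
    λ (_ , x∈) (_ , y∈) → mk⇔
      (reflects _ _ ∘ subst₂ A (sym (vertex-label x∈)) (sym (vertex-label y∈)))
      (subst₂ A (vertex-label x∈) (vertex-label y∈) ∘ preserves)
    where
    vertex : Fin 3 → Fin n
    vertex zero             = a
    vertex (suc zero)       = b
    vertex (suc (suc zero)) = c

    vertex∈ : ∀ i → vertex i ∈ ⁅ a ⨾ b ⨾ c ⁆
    vertex∈ zero             = ∈⁅⨾⨾⁆⁺ (inj₁ refl)
    vertex∈ (suc zero)       = ∈⁅⨾⨾⁆⁺ (inj₂ (inj₁ refl))
    vertex∈ (suc (suc zero)) = ∈⁅⨾⨾⁆⁺ (inj₂ (inj₂ refl))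

    labelled : ∀ {x} → x ∈ ⁅ a ⨾ b ⨾ c ⁆ → ∃ λ i → vertex i ≡ x
    labelled x∈ with ∈⁅⨾⨾⁆⁻ x∈
    ... | inj₁ x≡a        = zero , sym x≡a
    ... | inj₂ (inj₁ x≡b) = suc zero , sym x≡b
    ... | inj₂ (inj₂ x≡c) = suc (suc zero) , sym x≡c

    label : ∀ {x} → x ∈ ⁅ a ⨾ b ⨾ c ⁆ → Fin 3
    label x∈ = proj₁ (labelled x∈)

    vertex-label : ∀ {x} (x∈ : x ∈ ⁅ a ⨾ b ⨾ c ⁆) → vertex (label x∈) ≡ x
    vertex-label x∈ = proj₂ (labelled x∈)

    preserves : ∀ {i j} → CycleArc i j → A (vertex i) (vertex j)
    preserves arc01 = a→b
    preserves arc12 = b→c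
    preserves arc20 = c→a

    -- Distinct labels are joined by an arc of the model, which `preserves` sends to an arc of `T`,
    -- and arcs have distinct ends.
    vertex-injective : ∀ {i j} → vertex i ≡ vertex j → i ≡ j
    vertex-injective {i} {j} eq with i ≟ j
    ... | yes i≡j = i≡j
    ... | no  i≢j with Tournament.exactlyOne cycle₃ i≢j
    ...   | inj₁ (i→j , _) = contradiction eq (arc⇒≢ (preserves i→j))
    ...   | inj₂ (j→i , _) = contradiction (sym eq) (arc⇒≢ (preserves j→i))

    reflects : ∀ i j → A (vertex i) (vertex j) → CycleArc i j
    reflects i j vi→vj with Tournament.exactlyOne cycle₃ (arc⇒≢ vi→vj ∘ cong vertex)
    ... | inj₁ (i→j , _) = i→j
    ... | inj₂ (j→i , _) = contradiction (preserves j→i) (asym vi→vj)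

    ∃-≡ : ∀ {x y} {x∈ : x ∈ ⁅ a ⨾ b ⨾ c ⁆} {y∈ : y ∈ ⁅ a ⨾ b ⨾ c ⁆} → x ≡ y →
          _≡_ {A = ∃ λ v → v ∈ ⁅ a ⨾ b ⨾ c ⁆} (x , x∈) (y , y∈)
    ∃-≡ {x} {x∈ = x∈} {y∈} refl = cong (x ,_) ([]=-irrelevant x∈ y∈)

  -- The isomorphism carries the claim over to `arc-third`. One known arc of an edge thus fixes the
  -- orientation of the whole cycle.
  edge-third : ∀ {e a b c} → E e → a ∈ e → b ∈ e → c ∈ e → A a b → c ≢ a → c ≢ b → A b c
  edge-third (_ , f , f-arc) a∈ b∈ c∈ a→b c≢a c≢b =
    Equivalence.from (f-arc (_ , b∈) (_ , c∈))
      (arc-third (Equivalence.to (f-arc (_ , a∈) (_ , b∈)) a→b)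
        (c≢a ∘ cong proj₁ ∘ to-injective) (c≢b ∘ cong proj₁ ∘ to-injective))
    where open Injection (Inverse⇒Injection f) using () renaming (injective to to-injective)

  -- The cycle is read off from a prescribed starting vertex, so that a vertex of a module can come
  -- first.
  edge⇒cycle : ∀ {e a} → E e → a ∈ e →
    ∃₂ λ b c → A a b × A b c × A c a × e ≡ ⁅ a ⨾ b ⨾ c ⁆
  edge⇒cycle {e} {a} (_ , f , f-arc) a∈e =
    proj₁ b , proj₁ c , a→b , b→c , c→a , ⊆-antisym e⊆ ⊆e
    where
    open Inverse f using (to; from; strictlyInverseˡ; strictlyInverseʳ)
    i = to (a , a∈e)
    b = from (next i)
    c = from (next (next i))

    -- The label `j` is kept apart from `to u`, so that `u` may be `(a , a∈e)` or a vertex given as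
    -- a preimage.
    arc-from : ∀ {u} j → to u ≡ j → A (proj₁ u) (proj₁ (from (next j)))
    arc-from {u} j eq = Equivalence.from (f-arc u (from (next j)))
      (subst₂ CycleArc (sym eq) (sym (strictlyInverseˡ (next j))) (arc-next j))

    from-i : from i ≡ (a , a∈e)
    from-i = strictlyInverseʳ (a , a∈e)

    a→b : A a (proj₁ b)
    a→b = arc-from i refl
    b→c : A (proj₁ b) (proj₁ c)
    b→c = arc-from (next i) (strictlyInverseˡ (next i))
    c→a : A (proj₁ c) a
    c→a = subst (A (proj₁ c)) (cong proj₁ (trans (cong from (next³ i)) from-i))
            (arc-from (next (next i)) (strictlyInverseˡ (next (next i))))

    from-≡ : ∀ {u j} → to u ≡ j → proj₁ u ≡ proj₁ (from j)
    from-≡ {u} eq = cong proj₁ (trans (sym (strictlyInverseʳ u)) (cong from eq))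

    e⊆ : e ⊆ ⁅ a ⨾ proj₁ b ⨾ proj₁ c ⁆
    e⊆ {x} x∈e with next-covers i (to (x , x∈e))
    ... | inj₁ eq        = ∈⁅⨾⨾⁆⁺ (inj₁ (trans (from-≡ eq) (cong proj₁ from-i)))
    ... | inj₂ (inj₁ eq) = ∈⁅⨾⨾⁆⁺ (inj₂ (inj₁ (from-≡ eq)))
    ... | inj₂ (inj₂ eq) = ∈⁅⨾⨾⁆⁺ (inj₂ (inj₂ (from-≡ eq)))

    ⊆e : ⁅ a ⨾ proj₁ b ⨾ proj₁ c ⁆ ⊆ e
    ⊆e x∈ with ∈⁅⨾⨾⁆⁻ x∈
    ... | inj₁ refl        = a∈e
    ... | inj₂ (inj₁ refl) = proj₂ b
    ... | inj₂ (inj₂ refl) = proj₂ c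

  -- From modules of the tournament to modules of the hypergraph.

  module-C₃ : ∀ {M} → IsTournamentModule T M → IsHypergraphModule (C₃ T) M
  module-C₃ {M} M-mod e e∈E (m , m∈e∩M) (w , w∈e─M)
    with x∈p∩q⁻ e M m∈e∩M
  ... | m∈e , m∈M with edge⇒cycle e∈E m∈e
  ...   | p , q , m→p , p→q , q→m , refl =
    m , m∈M , ⊆-antisym ∩⊆ ⊆∩ ,
    λ v v∈M → subst E (⊆-antisym (⊆swap v) (swap⊆ v))
      (cycle⇒edge (v→p v v∈M) p→q (q→v v v∈M))
    where
    -- The vertex `w` is `p` or `q`. Were the other one in `M`, the cycle would pass from `M`
    -- through `w` back into `M`, forcing `w` into `M`.
    p,q∉M : p ∉ M × q ∉ M
    p,q∉M with ∈⁅⨾⨾⁆⁻ (p─q⊆p e M w∈e─M) | x∈p─q⇒x∉q e M w∈e─M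
    ... | inj₁ refl        | m∉M = contradiction m∈M m∉M
    ... | inj₂ (inj₁ refl) | p∉M = p∉M , λ q∈M → p∉M (M-mod m q p m∈M q∈M m→p p→q)
    ... | inj₂ (inj₂ refl) | q∉M = (λ p∈M → q∉M (M-mod p m q p∈M m∈M p→q q→m)) , q∉M
    p∉M = proj₁ p,q∉M
    q∉M = proj₂ p,q∉M

    ∩⊆ : e ∩ M ⊆ ⁅ m ⁆
    ∩⊆ x∈ with x∈p∩q⁻ e M x∈
    ... | x∈e , x∈M with ∈⁅⨾⨾⁆⁻ x∈e
    ...   | inj₁ refl        = x∈⁅x⁆ m
    ...   | inj₂ (inj₁ refl) = contradiction x∈M p∉M
    ...   | inj₂ (inj₂ refl) = contradiction x∈M q∉M

    ⊆∩ : ⁅ m ⁆ ⊆ e ∩ M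
    ⊆∩ x∈ = subst (_∈ e ∩ M) (sym (x∈⁅y⁆⇒x≡y m x∈)) m∈e∩M

    -- Otherwise the path `m → p → v` would put `p` into `M`; `q→v` is dual.
    v→p : ∀ v → v ∈ M → A v p
    v→p v v∈M = ↛⇒← (λ { refl → p∉M v∈M }) (p∉M ∘ M-mod m v p m∈M v∈M m→p)

    q→v : ∀ v → v ∈ M → A q v
    q→v v v∈M = ↛⇒← (λ { refl → q∉M v∈M }) (λ v→q → q∉M (M-mod v m q v∈M m∈M v→q q→m))

    swap⊆ : ∀ v → (e ─ ⁅ m ⁆) ∪ ⁅ v ⁆ ⊆ ⁅ v ⨾ p ⨾ q ⁆
    swap⊆ v x∈ with x∈p∪q⁻ (e ─ ⁅ m ⁆) ⁅ v ⁆ x∈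
    ... | inj₂ x∈v = ∈⁅⨾⨾⁆⁺ (inj₁ (x∈⁅y⁆⇒x≡y v x∈v))
    ... | inj₁ x∈e-m with ∈⁅⨾⨾⁆⁻ (p─q⊆p e ⁅ m ⁆ x∈e-m)
    ...   | inj₁ refl = contradiction (x∈⁅x⁆ m) (x∈p─q⇒x∉q e ⁅ m ⁆ x∈e-m)
    ...   | inj₂ x≡p⊎x≡q = ∈⁅⨾⨾⁆⁺ (inj₂ x≡p⊎x≡q)

    ⊆swap : ∀ v → ⁅ v ⨾ p ⨾ q ⁆ ⊆ (e ─ ⁅ m ⁆) ∪ ⁅ v ⁆
    ⊆swap v x∈ with ∈⁅⨾⨾⁆⁻ x∈
    ... | inj₁ refl = x∈p∪q⁺ (inj₂ (x∈⁅x⁆ v))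
    ... | inj₂ (inj₁ refl) = x∈p∪q⁺ (inj₁ (x∈p∧x∉q⇒x∈p─q (∈⁅⨾⨾⁆⁺ (inj₂ (inj₁ refl)))
                               (arc⇒≢ m→p ∘ sym ∘ x∈⁅y⁆⇒x≡y m)))
    ... | inj₂ (inj₂ refl) = x∈p∪q⁺ (inj₁ (x∈p∧x∉q⇒x∈p─q (∈⁅⨾⨾⁆⁺ (inj₂ (inj₂ refl)))
                               (arc⇒≢ q→m ∘ x∈⁅y⁆⇒x≡y m)))

  -- From a module of the hypergraph to modules of the tournament.

  module _ {M : Subset n} (M-mod : IsHypergraphModule (C₃ T) M) where

    -- The edge formed by such a cycle would meet `M` in a singleton, identifying `x` with `y`.
    no-cycle-2-1 : ∀ {x y v} → x ∈ M → y ∈ M → v ∉ M → A x v → A v y → ¬ A y x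
    no-cycle-2-1 {x} {y} {v} x∈M y∈M v∉M x→v v→y y→x
      with M-mod ⁅ x ⨾ v ⨾ y ⁆ (cycle⇒edge x→v v→y y→x)
             (x , x∈p∩q⁺ (∈⁅⨾⨾⁆⁺ (inj₁ refl) , x∈M))
             (v , x∈p∧x∉q⇒x∈p─q (∈⁅⨾⨾⁆⁺ (inj₂ (inj₁ refl))) v∉M)
    ... | m , _ , e∩M≡m , _ = arc⇒≢ y→x (trans (≡m (inj₂ (inj₂ refl)) y∈M) (sym (≡m (inj₁ refl) x∈M)))
      where
      ≡m : ∀ {z} → z ≡ x ⊎ z ≡ v ⊎ z ≡ y → z ∈ M → z ≡ m
      ≡m z≡ z∈M = x∈⁅y⁆⇒x≡y m (subst (_ ∈_) e∩M≡m (x∈p∩q⁺ (∈⁅⨾⨾⁆⁺ z≡ , z∈M)))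

    -- Exchanging `x` for `y` yields another edge, and the unchanged arc `v → w` determines its
    -- orientation.
    cycle-replace : ∀ {x y v w} → x ∈ M → y ∈ M → v ∉ M → w ∉ M →
      A x v → A v w → A w x → A y v × A w y
    cycle-replace {x} {y} {v} {w} x∈M y∈M v∉M w∉M x→v v→w w→x
      with M-mod ⁅ x ⨾ v ⨾ w ⁆ (cycle⇒edge x→v v→w w→x)
             (x , x∈p∩q⁺ (∈⁅⨾⨾⁆⁺ (inj₁ refl) , x∈M))
             (v , x∈p∧x∉q⇒x∈p─q (∈⁅⨾⨾⁆⁺ (inj₂ (inj₁ refl))) v∉M)
    ... | m , m∈M , _ , replace = y→v , w→y
      where
      -- The removed vertex `m` is used only through `m ∈ M`: this already shows that `v` and `w`
      -- survive the exchange.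
      e′ = (⁅ x ⨾ v ⨾ w ⁆ ─ ⁅ m ⁆) ∪ ⁅ y ⁆

      M-distinct : ∀ {a b} → a ∈ M → b ∉ M → a ≢ b
      M-distinct a∈M b∉M refl = b∉M a∈M

      kept : ∀ {z} → z ≡ x ⊎ z ≡ v ⊎ z ≡ w → z ∉ M → z ∈ e′
      kept z≡ z∉M = x∈p∪q⁺ (inj₁ (x∈p∧x∉q⇒x∈p─q (∈⁅⨾⨾⁆⁺ z≡)
        (M-distinct m∈M z∉M ∘ sym ∘ x∈⁅y⁆⇒x≡y m)))

      v∈e′ = kept (inj₂ (inj₁ refl)) v∉M
      w∈e′ = kept (inj₂ (inj₂ refl)) w∉M
      y∈e′ : y ∈ e′
      y∈e′ = x∈p∪q⁺ (inj₂ (x∈⁅x⁆ y))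

      w→y : A w y
      w→y = edge-third (replace y y∈M) v∈e′ w∈e′ y∈e′ v→w
              (M-distinct y∈M v∉M) (M-distinct y∈M w∉M)
      y→v : A y v
      y→v = edge-third (replace y y∈M) w∈e′ y∈e′ v∈e′ w→y
              (arc⇒≢ v→w) (M-distinct y∈M v∉M ∘ sym)

    Splits : Fin n → Set
    Splits v = (∃ λ x → x ∈ M × A x v) × (∃ λ y → y ∈ M × A v y)

    splits? : Decidable Splits
    splits? v = any? (λ x → (x ∈? M) ×-dec A? x v) ×-dec any? (λ y → (y ∈? M) ×-dec A? v y)

    -- Vertices of `M` may also satisfy `Splits`; the union absorbs them, and `hull⁻` restores the
    -- restriction to vertices outside `M`.
    hull : Subset n
    hull = M ∪ satisfying splits?

    hull⁻ : ∀ {v} → v ∈ hull → v ∉ M → Splits v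
    hull⁻ v∈ v∉M with x∈p∪q⁻ M _ v∈
    ... | inj₁ v∈M = contradiction v∈M v∉M
    ... | inj₂ v∈I = ∈-satisfying⁻ splits? v∈I

    hull-module : IsTournamentModule T hull
    hull-module x y v x∈ y∈ x→v v→y with v ∈? hull
    ... | yes v∈ = v∈
    ... | no  v∉ = contradiction (∈-satisfying⁺ splits? (in-neighbour , out-neighbour)) v∉I
      where
      v∉M : v ∉ M
      v∉M = v∉ ∘ x∈p∪q⁺ ∘ inj₁
      v∉I : v ∉ satisfying splits?
      v∉I = v∉ ∘ x∈p∪q⁺ ∘ inj₂
      ≢v : ∀ {z} → z ∈ M → z ≢ v
      ≢v z∈M refl = v∉M z∈M

      -- If v dominated M, then x would lie outside M, and v, x and an in-neighbour
      -- of x in M would form a 3-cycle; replacing the latter by an out-neighbour of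
      -- x in M destroys the cycle.  The other half is dual.
      in-neighbour : ∃ λ a → a ∈ M × A a v
      in-neighbour with x ∈? M
      ... | yes x∈M = x , x∈M , x→v
      ... | no  x∉M with hull⁻ x∈ x∉M
      ...   | (a , a∈M , a→x) , (b , b∈M , x→b) with A? a v
      ...     | yes a→v = a , a∈M , a→v
      ...     | no  a↛v = contradiction
                  (proj₁ (cycle-replace a∈M b∈M x∉M v∉M a→x x→v (↛⇒← (≢v a∈M) a↛v)))
                  (asym x→b)

      out-neighbour : ∃ λ a → a ∈ M × A v a
      out-neighbour with y ∈? M
      ... | yes y∈M = y , y∈M , v→y
      ... | no  y∉M with hull⁻ y∈ y∉M
      ...   | (a , a∈M , a→y) , (b , b∈M , y→b) with A? v b
      ...     | yes v→b = b , b∈M , v→b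
      ...     | no  v↛b = contradiction
                  (proj₂ (cycle-replace b∈M a∈M v∉M y∉M (↛⇒← (≢v b∈M ∘ sym) v↛b) v→y y→b))
                  (asym a→y)

    -- The chain of in-neighbourhoods inside `M`.

    M⁻? : ∀ v → Decidable (λ x → x ∈ M × A x v)
    M⁻? v x = (x ∈? M) ×-dec A? x v

    M⁻ : Fin n → Subset n
    M⁻ v = satisfying (M⁻? v)

    -- Since `x → v → y`, an arc `y → x` would close a 3-cycle with exactly two vertices in `M`.
    M⁻-dominates : ∀ {v x y} → v ∉ M → x ∈ M⁻ v → y ∈ M → y ∉ M⁻ v → A x y
    M⁻-dominates {v} v∉M x∈ y∈M y∉ with ∈-satisfying⁻ (M⁻? v) x∈
    ... | x∈M , x→v = ↛⇒← (λ { refl → y∉ x∈ }) (no-cycle-2-1 x∈M y∈M v∉M x→v v→y)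
      where
      v→y = ↛⇒← (λ { refl → v∉M y∈M }) (λ y→v → y∉ (∈-satisfying⁺ (M⁻? v) (y∈M , y→v)))

    Least : Fin n → Set
    Least v = v ∉ M × (∀ {w} → w ∉ M → M⁻ v ⊆ M⁻ w)

    -- If `M⁻ v` is not contained in some `M⁻ w`, the chain property makes `M⁻ w` a proper subset of
    -- `M⁻ v`; descending along such `w` terminates.
    least-M⁻ : ∀ {v} → v ∉ M → ∃ Least
    least-M⁻ v∉M = go v∉M (⊂-wellFounded _)
      where
      go : ∀ {v} → v ∉ M → Acc _⊂_ (M⁻ v) → ∃ Least
      go {v} v∉M (acc smaller)
        with any? (λ w → ¬? (w ∈? M) ×-dec any? (λ x → (x ∈? M⁻ v) ×-dec ¬? (x ∈? M⁻ w)))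
      ... | no none = v , v∉M , λ {w} w∉M {x} x∈ →
              decidable-stable (x ∈? M⁻ w) λ x∉ → none (w , w∉M , x , x∈ , x∉)
      ... | yes (w , w∉M , x , x∈ , x∉) = go w∉M (smaller (w⊆v , x , x∈ , x∉))
        where
        M⁻⊆M : ∀ {u y} → y ∈ M⁻ u → y ∈ M
        M⁻⊆M {u} = proj₁ ∘ ∈-satisfying⁻ (M⁻? u)
        -- If `y` lay in `M⁻ w` but not in `M⁻ v`, then `x` and `y` would dominate each other.
        w⊆v : M⁻ w ⊆ M⁻ v
        w⊆v {y} y∈ = decidable-stable (y ∈? M⁻ v) λ y∉ →
          asym (M⁻-dominates v∉M x∈ (M⁻⊆M y∈) y∉) (M⁻-dominates w∉M y∈ (M⁻⊆M x∈) x∉)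

    nontrivial⇒¬prime : Nontrivial M → ¬ PrimeTournament T
    nontrivial⇒¬prime ((x , y , x∈M , y∈M , x≢y) , z , z∉M) (_ , T-trivial)
      with least-M⁻ z∉M
    ... | v , v∉M , least = x∈∁p⇒x∉p (∁-all a) a∈C
      where
      all-hull : ∀ u → u ∈ hull
      all-hull = trivial-⊤ (T-trivial hull hull-module)
        (x∈p∪q⁺ (inj₁ x∈M)) (x∈p∪q⁺ (inj₁ y∈M)) x≢y

      C = M⁻ v

      -- A vertex of `M` outside `C` is dominated by `M⁻-dominates`; a vertex `u` outside `M` is
      -- dominated because leastness puts `c` into `M⁻ u`.
      C-dominates : ∀ {c u} → c ∈ C → u ∉ C → A c u
      C-dominates {c} {u} c∈C u∉C with u ∈? M
      ... | yes u∈M = M⁻-dominates v∉M c∈C u∈M u∉C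
      ... | no  u∉M = proj₂ (∈-satisfying⁻ (M⁻? u) (least u∉M c∈C))

      ∁-module : IsTournamentModule T (∁ C)
      ∁-module p q u p∈ q∈ p→u u→q with u ∈? C
      ... | no  u∉C = x∉p⇒x∈∁p u∉C
      ... | yes u∈C = contradiction (C-dominates u∈C (x∈∁p⇒x∉p p∈)) (asym p→u)

      -- As the hull is everything, `v` splits `M`: the in-neighbour `a` shows that `C` is nonempty,
      -- and the out-neighbour `b` lies in `M` but not in `C`.
      split-v = hull⁻ (all-hull v) v∉M
      a = proj₁ (proj₁ split-v)
      b = proj₁ (proj₂ split-v)

      a∈C : a ∈ C
      a∈C = ∈-satisfying⁺ (M⁻? v) (proj₂ (proj₁ split-v))

      v→b : A v b
      v→b = proj₂ (proj₂ (proj₂ split-v))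

      ∁-all : ∀ u → u ∈ ∁ C
      -- The distinct vertices `v` and `b` both avoid `C`, so primality makes the complement
      -- everything, against `a`.
      ∁-all = trivial-⊤ (T-trivial (∁ C) ∁-module)
        (x∉p⇒x∈∁p (v∉M ∘ proj₁ ∘ ∈-satisfying⁻ (M⁻? v)))
        (x∉p⇒x∈∁p (asym v→b ∘ proj₂ ∘ ∈-satisfying⁻ (M⁻? v)))
        (arc⇒≢ v→b)

  C₃-prime⇔prime : PrimeHypergraph (C₃ T) ⇔ PrimeTournament T
  C₃-prime⇔prime = mk⇔ (map₂ λ H-trivial M → H-trivial M ∘ module-C₃) prime⇒C₃-prime
    where
    prime⇒C₃-prime : PrimeTournament T → PrimeHypergraph (C₃ T)
    prime⇒C₃-prime T-prime@(3≤n , _) = 3≤n , trivial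
      where
      trivial : ∀ M → IsHypergraphModule (C₃ T) M → Trivial M
      trivial M M-mod with trivial⊎nontrivial M
      ... | inj₁ M-trivial    = M-trivial
      ... | inj₂ M-nontrivial = contradiction T-prime (nontrivial⇒¬prime M-mod M-nontrivial)

-- Transfer to an arbitrary hypergraph with the same edges.

≐-sym : ∀ {H K : Hypergraph n} → H ≐ K → K ≐ H
≐-sym H≐K e = mk⇔ (Equivalence.from (H≐K e)) (Equivalence.to (H≐K e))

module-resp-≐ : ∀ {H K : Hypergraph n} → H ≐ K → ∀ {M} →
  IsHypergraphModule H M → IsHypergraphModule K M
module-resp-≐ H≐K M-mod e e∈K meets leaves
  with M-mod e (Equivalence.from (H≐K e) e∈K) meets leaves
... | m , m∈M , e∩M≡m , replace = m , m∈M , e∩M≡m , λ v v∈M → Equivalence.to (H≐K _) (replace v v∈M)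

prime-resp-≐ : ∀ {H K : Hypergraph n} → H ≐ K → PrimeHypergraph H → PrimeHypergraph K
prime-resp-≐ {H = H} {K} H≐K = map₂ λ trivial M →
  trivial M ∘ module-resp-≐ {H = K} {H} (≐-sym {H = H} {K} H≐K)

theorem11 : ∀ (n : ℕ) (H : Hypergraph n) → Realizable H →
    ∀ (T : Tournament (Fin n)) → T Realizes H → PrimeHypergraph H ⇔ PrimeTournament T
theorem11 n H _ T H≐C₃T = mk⇔
  (Equivalence.to (C₃-prime⇔prime T) ∘ prime-resp-≐ {H = H} {C₃ T} H≐C₃T)
  (prime-resp-≐ {H = C₃ T} {H} (≐-sym {H = H} {C₃ T} H≐C₃T) ∘ Equivalence.from (C₃-prime⇔prime T))
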